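{- Let $|q|<1$ and define the coefficients $D'(2,1,n)$ by \[ \sum_{n\geq 0}D'(2,1,n) q^n = \sum_{n\geq 0} q^{2n+2} \frac{(q^{2n+4},q^{2n+6};q^2)_\infty}{(q^{2n+3};q^2)_\infty^2}. \] Then $D'(2,1,n)\geq 0$ for all nonnegative integers $n$.
   Context: For $|q|<1$: $(a;q)_\infty=\prod_{j\geq 0}(1-aq^j)$ and $(a,b;q)_\infty=(a;q)_\infty(b;q)_\infty$. -}

module Defs where

open import Data.Nat as ℕ using (ℕ; zero; suc; _∸_)
open import Data.Nat.Divisibility using (_∣?_)
open import Data.Integer using (ℤ; _+_; _-_; _*_; 0ℤ; 1ℤ)
open import Relation.Nullary.Decidable using (does)
open import Data.Bool using (if_then_else_)

FPS : Set
FPS = ℕ → ℤ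

sumTo : ℕ → (ℕ → ℤ) → ℤ
sumTo zero    f = f 0
sumTo (suc n) f = sumTo n f + f (suc n)

_⊛_ : FPS → FPS → FPS
(f ⊛ g) n = sumTo n (λ k → f k * g (n ∸ k))
infixl 7 _⊛_

one : FPS
one zero    = 1ℤ
one (suc _) = 0ℤ

qPow : ℕ → FPS
qPow m n = if does (m ℕ.≟ n) then 1ℤ else 0ℤ

oneMinusQ : ℕ → FPS
oneMinusQ m n = one n - qPow m n

-- 1 / (1 - q^(suc k)) = Σ_{i ≥ 0} q^{(suc k) i}   (geometric series)
geomSuc : ℕ → FPS
geomSuc k n = if does (suc k ∣? n) then 1ℤ else 0ℤ

finProd : ℕ → (ℕ → FPS) → FPS
finProd zero    F = one
finProd (suc N) F = finProd N F ⊛ F N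

-- (q^(suc a); q^2)_∞ = ∏_{j ≥ 0} (1 - q^{suc a + 2j}).
-- Every factor with j ≥ n+1 has exponent > n, hence does not affect the
-- coefficient of q^n; so the coefficient of q^n of the infinite product is
-- that of the finite product over j ≤ n.
pochSucQ2 : ℕ → FPS
pochSucQ2 a n = finProd (suc n) (λ j → oneMinusQ (suc a ℕ.+ 2 ℕ.* j)) n

-- 1 / (q^(suc a); q^2)_∞ = ∏_{j ≥ 0} 1/(1 - q^{suc a + 2j}), same truncation.
invPochSucQ2 : ℕ → FPS
invPochSucQ2 a n = finProd (suc n) (λ j → geomSuc (a ℕ.+ 2 ℕ.* j)) n

summand : ℕ → FPS
summand m =
  qPow (2 ℕ.* m ℕ.+ 2)
  ⊛ pochSucQ2 (2 ℕ.* m ℕ.+ 3)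
  ⊛ pochSucQ2 (2 ℕ.* m ℕ.+ 5)
  ⊛ invPochSucQ2 (2 ℕ.* m ℕ.+ 2)
  ⊛ invPochSucQ2 (2 ℕ.* m ℕ.+ 2)

-- D'(2,1,N) = [q^N] Σ_{m ≥ 0} summand m.  Summands with 2m+2 > N have zero
-- coefficient at q^N, so the sum over m ≤ N is exact.
D'₂₁ : ℕ → ℤ
D'₂₁ N = sumTo N (λ m → summand m N)

{-# OPTIONS --safe #-}
module Submission where

-- With Uₘ = (q^(2m+2), q^(2m+4); q²)_∞ / (q^(2m+3); q²)²_∞ the m-th summand is
-- (Uₘ₊₁ - Uₘ)/(1-q)², so the sum telescopes to
--   1/(1-q)² - ψ(q)²/(1-q²),  ψ(q) = (q²;q²)_∞/(q;q²)_∞ = ∑ q^(s(s+1)/2)  (Gauss).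
-- Hence D'(2,1,n) = n + 1 - #{(a,b) : Tₐ + T_b ≤ n, Tₐ + T_b ≡ n mod 2} with T
-- the triangular numbers. The count is about πn/4: among the first L triangular
-- numbers at most (L+1)/2 have a given parity, which bounds the number of b for
-- each a, and replacing the resulting square root by a tangent line leaves a
-- polynomial inequality that holds for n ≥ 36; smaller n are checked by computation.

open import Defs
open import Algebra.Bundles using (CommutativeRing)
import Algebra.Properties.Ring as RingProperties
import Algebra.Solver.Ring as RingSolver
open import Algebra.Solver.Ring.AlmostCommutativeRing
  using (_-Raw-AlmostCommutative⟶_; fromCommutativeRing; Induced-equivalence)
open import Data.Bool using (if_then_else_)
open import Data.Integer as ℤ using (ℤ)
import Data.Integer.Properties as ℤ
open import Data.Integer.Solver renaming (module +-*-Solver to ℤ-Solver)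
open import Data.Maybe using (just; nothing)
open import Data.Nat as ℕ using (ℕ; zero; suc; _∸_; z≤n; s≤s)
open import Data.Nat.Divisibility using (_∣?_; ∣⇒≤; _∣0; ∣m∣n⇒∣m+n; ∣m+n∣m⇒∣n; ∣-refl; 1∣_)
import Data.Nat.Properties as ℕ
open import Data.Nat.Solver renaming (module +-*-Solver to ℕ-Solver)
open import Data.Product using (∃; _×_; _,_)
open import Data.Sum using (inj₁; inj₂)
open import Function using (_∘_)
open import Function.Bundles using (mk⇔)
open import Level using (0ℓ; _⊔_)
open import Relation.Binary.Definitions using (WeaklyDecidable)
open import Relation.Binary.PropositionalEquality as ≡ using (_≡_)
import Relation.Binary.Reasoning.Setoid as SetoidReasoning
open import Relation.Nullary using (yes; no; contradiction)
open import Relation.Nullary.Decidable using (dec-true; dec-false; does-⇔; from-yes)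

-- Triangular numbers and index arithmetic.

tri : ℕ → ℕ
tri zero    = 0
tri (suc n) = suc n ℕ.+ tri n

-- The exponents n(2n+1) and (n+1)(2n+1) produced by each step of the finite Gauss identity are
-- consecutive triangular numbers; the two cases call each other along the recursion of `tri`.
tri-even : ∀ n → tri (2 ℕ.* n) ≡ n ℕ.* suc (2 ℕ.* n)
tri-odd  : ∀ n → tri (suc (2 ℕ.* n)) ≡ suc n ℕ.* suc (2 ℕ.* n)
tri-even zero    = ≡.refl
tri-even (suc n) = begin
  tri (2 ℕ.* suc n)                                  ≡⟨ ≡.cong tri (ℕ.*-suc 2 n) ⟩
  suc (suc (2 ℕ.* n)) ℕ.+ tri (suc (2 ℕ.* n))        ≡⟨ ≡.cong (suc (suc (2 ℕ.* n)) ℕ.+_) (tri-odd n) ⟩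
  suc (suc (2 ℕ.* n)) ℕ.+ suc n ℕ.* suc (2 ℕ.* n)    ≡⟨ solve 1 (λ n → con 2 :+ con 2 :* n :+ (con 1 :+ n) :* (con 1 :+ con 2 :* n)
                                                           := (con 1 :+ n) :* (con 1 :+ con 2 :* (con 1 :+ n))) ≡.refl n ⟩
  suc n ℕ.* suc (2 ℕ.* suc n)                        ∎
  where
  open ≡.≡-Reasoning
  open ℕ-Solver
tri-odd n = ≡.cong (suc (2 ℕ.* n) ℕ.+_) (tri-even n)

+-2*suc : ∀ a j → a ℕ.+ 2 ℕ.* suc j ≡ 2 ℕ.+ a ℕ.+ 2 ℕ.* j
+-2*suc = solve 2 (λ a j → a :+ con 2 :* (con 1 :+ j) := con 2 :+ a :+ con 2 :* j) ≡.refl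
  where open ℕ-Solver

*-odd-suc : ∀ m n → m ℕ.* suc (2 ℕ.* suc n) ≡ m ℕ.* suc (2 ℕ.* n) ℕ.+ 2 ℕ.* m
*-odd-suc = solve 2 (λ m n → m :* (con 1 :+ con 2 :* (con 1 :+ n)) := m :* (con 1 :+ con 2 :* n) :+ con 2 :* m) ≡.refl
  where open ℕ-Solver

-- Products of q-factors in an abstract truncated ring.

-- q k stands for q^k and g k for 1/(1 - q^(k+1)); powers beyond q^N vanish.
record TruncatedQRing c ℓ : Set (Level.suc (c ⊔ ℓ)) where
  field
    commutativeRing : CommutativeRing c ℓ
  open CommutativeRing commutativeRing public
  field
    fromℤ       : ℤ.+-*-rawRing -Raw-AlmostCommutative⟶ fromCommutativeRing commutativeRing
    q           : ℕ → Carrier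
    q-0         : q 0 ≈ 1#
    q-+         : ∀ m n → q (m ℕ.+ n) ≈ q m * q n
    g           : ℕ → Carrier
    O*g         : ∀ k → (1# - q (suc k)) * g k ≈ 1#
    N           : ℕ
    q-vanishes  : ∀ {m} → N ℕ.< m → q m ≈ 0#

module QProducts {c ℓ} (R : TruncatedQRing c ℓ) where

  open TruncatedQRing R
  open import Relation.Binary.Reasoning.Setoid setoid
  open RingProperties ring using (-0#≈0#)

  private
    fromℤ-≟ : WeaklyDecidable (Induced-equivalence fromℤ)
    fromℤ-≟ x y with x ℤ.≟ y
    ... | yes ≡.refl = just refl
    ... | no  _      = nothing

  open RingSolver ℤ.+-*-rawRing (fromCommutativeRing commutativeRing) fromℤ fromℤ-≟
    using (solve; _:+_; _:*_; _:-_; _:^_; _:=_; Polynomial)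

  -- con 1 denotes the image of 1 under fromℤ, which is not syntactically 1#.
  :1 : ∀ {n} → Polynomial n → Polynomial n
  :1 x = x :^ 0

  O : ℕ → Carrier
  O k = 1# - q k

  ∑< ∏< : ℕ → (ℕ → Carrier) → Carrier
  ∑< zero    F = 0#
  ∑< (suc n) F = ∑< n F + F n
  ∏< zero    F = 1#
  ∏< (suc n) F = ∏< n F * F n

  ∏<-cong : ∀ n {F G : ℕ → Carrier} → (∀ j → F j ≈ G j) → ∏< n F ≈ ∏< n G
  ∏<-cong zero    F≈G = refl
  ∏<-cong (suc n) F≈G = *-cong (∏<-cong n F≈G) (F≈G n)

  ∏<-1 : ∀ n {F : ℕ → Carrier} → (∀ j → F j ≈ 1#) → ∏< n F ≈ 1#
  ∏<-1 zero    F≈1 = refl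
  ∏<-1 (suc n) F≈1 = trans (*-cong (∏<-1 n F≈1) (F≈1 n)) (*-identityˡ 1#)

  ∏<-* : ∀ n (F G : ℕ → Carrier) → ∏< n (λ j → F j * G j) ≈ ∏< n F * ∏< n G
  ∏<-* zero    F G = sym (*-identityˡ 1#)
  ∏<-* (suc n) F G = begin
    ∏< n (λ j → F j * G j) * (F n * G n)  ≈⟨ *-congʳ (∏<-* n F G) ⟩
    (∏< n F * ∏< n G) * (F n * G n)       ≈⟨ solve 4 (λ a b c d → (a :* b) :* (c :* d) := (a :* c) :* (b :* d)) refl _ _ _ _ ⟩
    (∏< n F * F n) * (∏< n G * G n)       ∎

  ∏<-front : ∀ n (F : ℕ → Carrier) → ∏< (suc n) F ≈ F 0 * ∏< n (λ j → F (suc j))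
  ∏<-front zero    F = *-comm 1# (F 0)
  ∏<-front (suc n) F = trans (*-congʳ (∏<-front n F)) (*-assoc _ _ _)

  O-vanishing : ∀ {k} → N ℕ.< k → O k ≈ 1#
  O-vanishing N<k = trans (+-congˡ (-‿cong (q-vanishes N<k))) (trans (+-congˡ -0#≈0#) (+-identityʳ 1#))

  g-vanishing : ∀ {k} → N ℕ.≤ k → g k ≈ 1#
  g-vanishing {k} N≤k = begin
    g k               ≈⟨ *-identityˡ (g k) ⟨
    1# * g k          ≈⟨ *-congʳ (O-vanishing (s≤s N≤k)) ⟨
    O (suc k) * g k   ≈⟨ O*g k ⟩
    1#                ∎

  K : ℕ
  K = suc N

  -- `K = N + 1` factors stand for the infinite product: in the uses below, those with j > N are 1
  -- modulo q^(N+1).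
  step2 : (ℕ → Carrier) → ℕ → Carrier
  step2 F a = ∏< K (λ j → F (a ℕ.+ 2 ℕ.* j))

  -- Both products have K factors, so one more is appended at the end; its index a + 2K exceeds N,
  -- where `F` is already 1.
  step2-shift : ∀ {F} → (∀ {k} → N ℕ.≤ k → F k ≈ 1#) → ∀ a → step2 F a ≈ F a * step2 F (2 ℕ.+ a)
  step2-shift {F} F≈1 a = begin
    step2 F a                                      ≈⟨ *-identityʳ _ ⟨
    step2 F a * 1#                                 ≈⟨ *-congˡ (F≈1 (ℕ.≤-trans (ℕ.n≤1+n N) (ℕ.≤-trans (ℕ.m≤m+n K _) (ℕ.m≤n+m _ a)))) ⟨
    ∏< (suc K) (λ j → F (a ℕ.+ 2 ℕ.* j))           ≈⟨ ∏<-front K (λ j → F (a ℕ.+ 2 ℕ.* j)) ⟩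
    F (a ℕ.+ 0) * ∏< K (λ j → F (a ℕ.+ 2 ℕ.* suc j)) ≈⟨ *-cong (reflexive (≡.cong F (ℕ.+-identityʳ a)))
                                                       (∏<-cong K (λ j → reflexive (≡.cong F (+-2*suc a j)))) ⟩
    F a * step2 F (2 ℕ.+ a)                        ∎

  -- E a = (q^(a+1); q²)_∞ and I a = 1/(q^(a+1); q²)_∞.
  E I : ℕ → Carrier
  E = step2 (λ k → O (suc k))
  I = step2 g

  E-shift : ∀ a → E a ≈ O (suc a) * E (2 ℕ.+ a)
  E-shift = step2-shift (λ N≤k → O-vanishing (s≤s N≤k))

  I-shift : ∀ a → I a ≈ g a * I (2 ℕ.+ a)
  I-shift = step2-shift g-vanishing

  -- Telescoping of the summands.

  -- At b = 2m, `U b` is the telescoping quantity Uₘ and `V b` is the m-th summand.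
  U V : ℕ → Carrier
  U b = E (1 ℕ.+ b) * E (3 ℕ.+ b) * (I (2 ℕ.+ b) * I (2 ℕ.+ b))
  V b = q (2 ℕ.+ b) * E (3 ℕ.+ b) * E (5 ℕ.+ b) * I (2 ℕ.+ b) * I (2 ℕ.+ b)

  q-suc : ∀ m → q (suc m) ≈ q 1 * q m
  q-suc = q-+ 1

  -- With y = q^(b+2) this is (1 - yq)² - (1 - y)(1 - yq²) = y(1 - q)².
  U-step : ∀ b → U (2 ℕ.+ b) ≈ U b + O 1 * O 1 * V b
  U-step b = begin
    E₃ * E₅ * (I₄ * I₄)
      ≈⟨ solve 3 (λ e₃ e₅ i → e₃ :* e₅ :* (i :* i) := (:1 i :* (i :* e₃)) :* (:1 i :* (e₅ :* i))) refl E₃ E₅ I₄ ⟩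
    (1# * (I₄ * E₃)) * (1# * (E₅ * I₄))
      -- Each inserted 1 is (1 - q^(b+3))/(1 - q^(b+3)): the denominators extend `I₄` to
      -- `I (2 + b)`, the numerators feed the quadratic identity.
      ≈⟨ *-cong (*-congʳ 1≈) (*-congʳ 1≈) ⟩
    ((1# - q 1 * y) * G * (I₄ * E₃)) * ((1# - q 1 * y) * G * (E₅ * I₄))
      ≈⟨ solve 6 (λ x y g i e₃ e₅ →
           ((:1 x :- x :* y) :* g :* (i :* e₃)) :* ((:1 x :- x :* y) :* g :* (e₅ :* i))
           := (:1 x :- y) :* e₃ :* ((:1 x :- x :* (x :* y)) :* e₅) :* ((g :* i) :* (g :* i))
              :+ (:1 x :- x) :* (:1 x :- x) :* (y :* e₃ :* e₅ :* (g :* i) :* (g :* i)))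
           refl (q 1) y G I₄ E₃ E₅ ⟩
    (1# - y) * E₃ * ((1# - q 1 * (q 1 * y)) * E₅) * ((G * I₄) * (G * I₄))
      + O 1 * O 1 * (y * E₃ * E₅ * (G * I₄) * (G * I₄))
      ≈⟨ +-cong
           (*-cong (*-cong (sym (E-shift (1 ℕ.+ b))) (trans (*-congʳ O₄) (sym (E-shift (3 ℕ.+ b)))))
                   (*-cong I₂ I₂))
           (*-congˡ (*-cong (*-congˡ I₂) I₂)) ⟩
    U b + O 1 * O 1 * V b ∎
    where
    E₃ = E (3 ℕ.+ b)
    E₅ = E (5 ℕ.+ b)
    I₄ = I (4 ℕ.+ b)
    y  = q (2 ℕ.+ b)
    G  = g (2 ℕ.+ b)
    1≈ : 1# ≈ (1# - q 1 * y) * G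
    1≈ = trans (sym (O*g (2 ℕ.+ b))) (*-congʳ (+-congˡ (-‿cong (q-suc (2 ℕ.+ b)))))
    O₄ : 1# - q 1 * (q 1 * y) ≈ O (4 ℕ.+ b)
    O₄ = +-congˡ (-‿cong (sym (trans (q-suc (3 ℕ.+ b)) (*-congˡ (q-suc (2 ℕ.+ b))))))
    I₂ : G * I₄ ≈ I (2 ℕ.+ b)
    I₂ = sym (I-shift (2 ℕ.+ b))

  U-telescopes : ∀ n → U (2 ℕ.* n) ≈ U 0 + O 1 * O 1 * ∑< n (λ m → V (2 ℕ.* m))
  U-telescopes zero    = sym (trans (+-congˡ (zeroʳ _)) (+-identityʳ _))
  U-telescopes (suc n) = begin
    U (2 ℕ.* suc n)             ≈⟨ reflexive (≡.cong U (ℕ.*-suc 2 n)) ⟩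
    U (2 ℕ.+ 2 ℕ.* n)           ≈⟨ U-step (2 ℕ.* n) ⟩
    U (2 ℕ.* n) + c₁ * v        ≈⟨ +-congʳ (U-telescopes n) ⟩
    U 0 + c₁ * s + c₁ * v       ≈⟨ solve 4 (λ u c s v → u :+ c :* s :+ c :* v := u :+ c :* (s :+ v)) refl (U 0) c₁ s v ⟩
    U 0 + c₁ * (s + v)          ∎
    where
    c₁ = O 1 * O 1
    s  = ∑< n (λ m → V (2 ℕ.* m))
    v  = V (2 ℕ.* n)

  -- At m = K every exponent in Uₘ exceeds N, so the telescoped sum ends at 1.
  U-vanishing : U (2 ℕ.* K) ≈ 1#
  U-vanishing = begin
    U (2 ℕ.* K)      ≈⟨ *-cong (*-cong (E≈1 1) (E≈1 3)) (*-cong I≈1 I≈1) ⟩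
    1# * 1# * (1# * 1#) ≈⟨ solve 1 (λ x → :1 x :* :1 x :* (:1 x :* :1 x) := :1 x) refl 1# ⟩
    1#               ∎
    where
    bound : ∀ i j → N ℕ.≤ i ℕ.+ 2 ℕ.* K ℕ.+ 2 ℕ.* j
    bound i j = ℕ.≤-trans (ℕ.n≤1+n N) (ℕ.≤-trans (ℕ.m≤m+n K _) (ℕ.≤-trans (ℕ.m≤n+m _ i) (ℕ.m≤m+n _ _)))
    E≈1 : ∀ i → E (i ℕ.+ 2 ℕ.* K) ≈ 1#
    E≈1 i = ∏<-1 K (λ j → O-vanishing (s≤s (bound i j)))
    I≈1 : I (2 ℕ.+ 2 ℕ.* K) ≈ 1#
    I≈1 = ∏<-1 K (λ j → g-vanishing (bound 2 j))

  -- Closed form of the sum.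

  -- `P n` is the partial product of (1 - q^(2j+2))/(1 - q^(2j+1)), and `r n` is its reciprocal; the
  -- index of `g` is one below its exponent.
  P r : ℕ → Carrier
  P n = ∏< n (λ j → O (2 ℕ.+ 2 ℕ.* j) * g (2 ℕ.* j))
  r n = ∏< n (λ j → O (1 ℕ.+ 2 ℕ.* j) * g (1 ℕ.+ 2 ℕ.* j))

  P*r : ∀ n → P n * r n ≈ 1#
  P*r n = trans (sym (∏<-* n _ _)) (∏<-1 n (λ j → begin
    (O (2 ℕ.+ 2 ℕ.* j) * g (2 ℕ.* j)) * (O (1 ℕ.+ 2 ℕ.* j) * g (1 ℕ.+ 2 ℕ.* j))
      ≈⟨ solve 4 (λ a b c d → (a :* b) :* (c :* d) := (a :* d) :* (c :* b)) refl _ _ _ _ ⟩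
    (O (2 ℕ.+ 2 ℕ.* j) * g (1 ℕ.+ 2 ℕ.* j)) * (O (1 ℕ.+ 2 ℕ.* j) * g (2 ℕ.* j))
      ≈⟨ *-cong (O*g _) (O*g _) ⟩
    1# * 1#
      ≈⟨ *-identityˡ 1# ⟩
    1# ∎))

  -- ∑ V = 1/(1-q)² - (q²;q²)²/((q;q²)² (1-q²)).
  ∑V : ∑< K (λ m → V (2 ℕ.* m)) ≈ g 0 * g 0 - g 1 * (P K * P K)
  ∑V = begin
    s                                         ≈⟨ solve 1 (λ s → s := s :* (:1 s :* :1 s)) refl s ⟩
    s * (1# * 1#)                             ≈⟨ *-congˡ (*-cong (sym (O*g 0)) (sym (O*g 0))) ⟩
    s * ((O 1 * g 0) * (O 1 * g 0))           ≈⟨ solve 4 (λ s o g u → s :* ((o :* g) :* (o :* g))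
                                                   := g :* g :* (u :+ o :* o :* s) :- g :* g :* u) refl s (O 1) (g 0) (U 0) ⟩
    g 0 * g 0 * (U 0 + O 1 * O 1 * s) - g 0 * g 0 * U 0
                                              -- The bracket is `U (2 * K)`, which is 1; only the
                                              -- initial value `U 0` remains.
                                              ≈⟨ +-cong (*-congˡ (trans (sym (U-telescopes K)) U-vanishing)) (-‿cong gU) ⟩
    g 0 * g 0 * 1# - g 1 * (P K * P K)        ≈⟨ +-congʳ (*-identityʳ _) ⟩
    g 0 * g 0 - g 1 * (P K * P K)             ∎
    where
    s = ∑< K (λ m → V (2 ℕ.* m))
    P≈ : P K ≈ E 1 * I 0
    P≈ = ∏<-* K _ _
    E₃ : E 3 ≈ g 1 * E 1
    E₃ = begin
      E 3                 ≈⟨ *-identityˡ _ ⟨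
      1# * E 3            ≈⟨ *-congʳ (O*g 1) ⟨
      O 2 * g 1 * E 3     ≈⟨ solve 3 (λ o g e → o :* g :* e := g :* (o :* e)) refl (O 2) (g 1) (E 3) ⟩
      g 1 * (O 2 * E 3)   ≈⟨ *-congˡ (E-shift 1) ⟨
      g 1 * E 1           ∎
    -- Each 1/(1-q) completes one `I 2` to `I 0`; the factor 1 - q² missing from `E 3` leaves the
    -- single `g 1`.
    gU : g 0 * g 0 * U 0 ≈ g 1 * (P K * P K)
    gU = begin
      g 0 * g 0 * (E 1 * E 3 * (I 2 * I 2))             ≈⟨ *-congˡ (*-congʳ (*-congˡ E₃)) ⟩
      g 0 * g 0 * (E 1 * (g 1 * E 1) * (I 2 * I 2))     ≈⟨ solve 4 (λ g₀ g₁ e i → g₀ :* g₀ :* (e :* (g₁ :* e) :* (i :* i))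
                                                            := g₁ :* ((e :* (g₀ :* i)) :* (e :* (g₀ :* i)))) refl (g 0) (g 1) (E 1) (I 2) ⟩
      g 1 * ((E 1 * (g 0 * I 2)) * (E 1 * (g 0 * I 2))) ≈⟨ *-congˡ (*-cong P≈′ P≈′) ⟩
      g 1 * (P K * P K)                                 ∎
      where
      P≈′ : E 1 * (g 0 * I 2) ≈ P K
      P≈′ = sym (trans P≈ (*-congˡ (I-shift 0)))

  -- Gauss's identity by Shanks' method.

  -- The number m of terms is independent of n because the step from n to n + 1 is proved by
  -- induction on m.
  S : ℕ → ℕ → Carrier
  S n m = ∑< m (λ s → r s * q (s ℕ.* suc (2 ℕ.* n)))

  -- Shanks' finite form of Gauss's identity (q²;q²)/(q;q²) = ∑ q^(s(s+1)/2):
  -- P n * S n n = ∑_{s < 2n} q^(s(s+1)/2), and S n n ≡ 1 modulo q^(2n+1).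
  S-step : ∀ n m → P (suc n) * S (suc n) m ≈
    P n * S n m + P n * g (2 ℕ.* n) * r m * q (m ℕ.* suc (2 ℕ.* n)) * O (2 ℕ.* m)
  -- The correction term carries `O (2 * m)`, which is 0 at m = 0.
  S-step n zero = begin
    P (suc n) * 0#                ≈⟨ zeroʳ _ ⟩
    0#                            ≈⟨ +-identityˡ 0# ⟨
    0# + 0#                       ≈⟨ +-cong (zeroʳ _) (trans (*-congˡ O0) (zeroʳ _)) ⟨
    P n * 0# + P n * g (2 ℕ.* n) * r 0 * q 0 * O 0 ∎
    where
    O0 : O 0 ≈ 0#
    O0 = trans (+-congˡ (-‿cong q-0)) (-‿inverseʳ 1#)
  S-step n (suc m) = begin
    P (suc n) * (S (suc n) m + r m * q (m ℕ.* suc (2 ℕ.* suc n)))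
      ≈⟨ distribˡ _ _ _ ⟩
    P (suc n) * S (suc n) m + P (suc n) * (r m * q (m ℕ.* suc (2 ℕ.* suc n)))
      ≈⟨ +-cong (S-step n m) (*-cong (*-congˡ (*-congʳ O₁)) (*-congˡ qx)) ⟩
    P n * S n m + P n * G * r m * X * O (2 ℕ.* m) + P n * ((1# - q 1 * x) * G) * (r m * (X * u))
      -- Apart from the term in `S n m`, both sides are p G r X (1 - qxu), by (1 - u) + (1 - qx)u =
      -- (1 - x) + x(1 - qu). Afterwards 1 - x cancels `G`, and 1 - qu goes into `r (suc m)`.
      ≈⟨ solve 8 (λ p s G r X u q x →
           p :* s :+ p :* G :* r :* X :* (:1 x :- u) :+ p :* ((:1 x :- q :* x) :* G) :* (r :* (X :* u))
           := p :* (s :+ r :* X :* ((:1 x :- x) :* G)) :+ p :* G :* (r :* ((:1 x :- q :* u) :* :1 x)) :* (x :* X))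
           refl (P n) (S n m) G (r m) X u (q 1) x ⟩
    P n * (S n m + r m * X * (O (suc (2 ℕ.* n)) * G)) + P n * G * (r m * ((1# - q 1 * u) * 1#)) * (x * X)
      ≈⟨ +-cong (*-congˡ (+-congˡ (trans (*-congˡ (O*g _)) (*-identityʳ _))))
                (*-cong (*-congˡ (*-congˡ (*-cong (+-congˡ (-‿cong (sym (q-suc (2 ℕ.* m))))) (sym (O*g (1 ℕ.+ 2 ℕ.* m))))))
                        (sym (q-+ (suc (2 ℕ.* n)) _))) ⟩
    P n * S n (suc m) + P n * G * (r m * (O (1 ℕ.+ 2 ℕ.* m) * (O (2 ℕ.+ 2 ℕ.* m) * g (1 ℕ.+ 2 ℕ.* m)))) * q (suc m ℕ.* suc (2 ℕ.* n))
      ≈⟨ +-congˡ (solve 7 (λ p G r a b c d → p :* G :* (r :* (a :* (b :* c))) :* d := p :* G :* (r :* (a :* c)) :* d :* b)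
           refl (P n) G (r m) _ _ _ _) ⟩
    P n * S n (suc m) + P n * G * r (suc m) * q (suc m ℕ.* suc (2 ℕ.* n)) * O (2 ℕ.+ 2 ℕ.* m)
      ≈⟨ +-congˡ (*-congˡ (reflexive (≡.cong O (≡.sym (ℕ.*-suc 2 m))))) ⟩
    P n * S n (suc m) + P n * G * r (suc m) * q (suc m ℕ.* suc (2 ℕ.* n)) * O (2 ℕ.* suc m) ∎
    where
    G = g (2 ℕ.* n)
    x = q (suc (2 ℕ.* n))
    X = q (m ℕ.* suc (2 ℕ.* n))
    u = q (2 ℕ.* m)
    O₁ : O (2 ℕ.+ 2 ℕ.* n) ≈ 1# - q 1 * x
    O₁ = +-congˡ (-‿cong (q-suc (suc (2 ℕ.* n))))
    qx : q (m ℕ.* suc (2 ℕ.* suc n)) ≈ X * u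
    qx = trans (reflexive (≡.cong q (*-odd-suc m n))) (q-+ (m ℕ.* suc (2 ℕ.* n)) (2 ℕ.* m))

  ψ : ℕ → Carrier
  ψ m = ∑< m (λ s → q (tri s))

  -- Induction through `S-step` at m = n + 1. Since `P n * r n` is 1, the last term of `S n (suc n)`
  -- becomes the power of q at `tri (2 * n)`, and the correction term the next one.
  shanks : ∀ n → P n * S n n ≈ ψ (2 ℕ.* n)
  shanks zero    = zeroʳ _
  shanks (suc n) = begin
    P (suc n) * S (suc n) (suc n)
      ≈⟨ S-step n (suc n) ⟩
    P n * (S n n + r n * q (n ℕ.* t)) + P n * g (2 ℕ.* n) * r (suc n) * q (suc n ℕ.* t) * O (2 ℕ.* suc n)
      ≈⟨ +-congˡ (*-congˡ (reflexive (≡.cong O (ℕ.*-suc 2 n)))) ⟩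
    P n * (S n n + r n * q (n ℕ.* t)) + P n * g (2 ℕ.* n) * r (suc n) * q (suc n ℕ.* t) * O (2 ℕ.+ 2 ℕ.* n)
      ≈⟨ solve 9 (λ p s r a g o₁ g₁ b o₂ →
           p :* (s :+ r :* a) :+ p :* g :* (r :* (o₁ :* g₁)) :* b :* o₂
           := p :* s :+ (p :* r) :* a :+ (p :* r) :* ((o₁ :* g) :* (o₂ :* g₁)) :* b)
           refl (P n) (S n n) (r n) (q (n ℕ.* t)) (g (2 ℕ.* n)) (O (1 ℕ.+ 2 ℕ.* n)) (g (1 ℕ.+ 2 ℕ.* n)) (q (suc n ℕ.* t)) (O (2 ℕ.+ 2 ℕ.* n)) ⟩
    P n * S n n + (P n * r n) * q (n ℕ.* t)
      + (P n * r n) * ((O (1 ℕ.+ 2 ℕ.* n) * g (2 ℕ.* n)) * (O (2 ℕ.+ 2 ℕ.* n) * g (1 ℕ.+ 2 ℕ.* n))) * q (suc n ℕ.* t)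
      ≈⟨ +-cong (+-cong (shanks n) (*-congʳ (P*r n))) (*-congʳ (*-cong (P*r n) (*-cong (O*g _) (O*g _)))) ⟩
    ψ (2 ℕ.* n) + 1# * q (n ℕ.* t) + 1# * (1# * 1#) * q (suc n ℕ.* t)
      ≈⟨ solve 3 (λ s a b → s :+ :1 s :* a :+ :1 s :* (:1 s :* :1 s) :* b := s :+ a :+ b) refl _ _ _ ⟩
    ψ (2 ℕ.* n) + q (n ℕ.* t) + q (suc n ℕ.* t)
      ≈⟨ +-cong (+-congˡ (reflexive (≡.cong q (≡.sym (tri-even n))))) (reflexive (≡.cong q (≡.sym (tri-odd n)))) ⟩
    ψ (2 ℕ.+ 2 ℕ.* n)
      ≈⟨ reflexive (≡.cong ψ (≡.sym (ℕ.*-suc 2 n))) ⟩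
    ψ (2 ℕ.* suc n) ∎
    where t = suc (2 ℕ.* n)

  gauss : P K ≈ ψ (2 ℕ.* K)
  gauss = begin
    P K             ≈⟨ *-identityʳ _ ⟨
    P K * 1#        ≈⟨ *-congˡ (S≈1 N) ⟨
    P K * S K K     ≈⟨ shanks K ⟩
    ψ (2 ℕ.* K)     ∎
    where
    -- Beyond s = 0 the exponent s(2K + 1) exceeds N.
    S≈1 : ∀ m → S K (suc m) ≈ 1#
    S≈1 zero    = trans (+-identityˡ _) (trans (*-identityˡ _) q-0)
    S≈1 (suc m) = begin
      S K (suc m) + r (suc m) * q (suc m ℕ.* suc (2 ℕ.* K))
        ≈⟨ +-cong (S≈1 m) (*-congˡ (q-vanishes (ℕ.≤-trans (ℕ.m≤m+n K _) (ℕ.≤-trans (ℕ.n≤1+n _) (ℕ.m≤m+n _ _))))) ⟩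
      1# + r (suc m) * 0#   ≈⟨ +-congˡ (zeroʳ _) ⟩
      1# + 0#               ≈⟨ +-identityʳ 1# ⟩
      1#                    ∎

  -- Bracketed with `ψ` outermost, so that the second term arises from `g 1` by multiplying with `ψ`
  -- twice.
  ∑V-gauss : ∑< K (λ m → V (2 ℕ.* m)) ≈ g 0 * g 0 - ψ (2 ℕ.* K) * (ψ (2 ℕ.* K) * g 1)
  ∑V-gauss = trans ∑V (+-congˡ (-‿cong (trans (*-congˡ (*-cong gauss gauss))
    (solve 2 (λ g p → g :* (p :* p) := p :* (p :* g)) refl (g 1) (ψ (2 ℕ.* K))))))

-- Counting pairs of triangular numbers.

module TriangularCount where
  open import Data.Nat
  open import Data.Nat.Properties
  open import Relation.Binary.PropositionalEquality

  -- Coefficients of q^t f, with `z` as zero; generic in `A` because both integer series and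
  -- natural-number counts are shifted.
  shift : {A : Set} → A → ℕ → (ℕ → A) → ℕ → A
  shift z zero    f n       = f n
  shift z (suc t) f zero    = z
  shift z (suc t) f (suc n) = shift z t f n

  sum< : ℕ → (ℕ → ℕ) → ℕ
  sum< zero    f = 0
  sum< (suc n) f = sum< n f + f n

  -- Coefficients of 1/(1 - q²).
  even : ℕ → ℕ
  even 0             = 1
  even 1             = 0
  even (suc (suc n)) = even n

  -- Coefficient of q^M in ψ/(1 - q²), with ψ cut to L terms: it counts the b < L with T_b ≤ M and
  -- T_b of the same parity as M. `total` does this for ψ²/(1 - q²).
  row : ℕ → ℕ → ℕ
  row L M = sum< L (λ b → shift 0 (tri b) even M)

  total : ℕ → ℕ → ℕ → ℕ
  total L L′ N = sum< L (λ a → shift 0 (tri a) (row L′) N)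

  shift-< : ∀ {A : Set} {z : A} t f n → n < t → shift z t f n ≡ z
  shift-< (suc t) f zero    _         = refl
  shift-< (suc t) f (suc n) (s≤s n<t) = shift-< t f n n<t

  shift-≤ : ∀ {A : Set} {z : A} t f n → t ≤ n → shift z t f n ≡ f (n ∸ t)
  shift-≤ zero    f n       _         = refl
  shift-≤ (suc t) f (suc n) (s≤s t≤n) = shift-≤ t f n t≤n

  shift-mono : ∀ t {f g : ℕ → ℕ} n → (∀ k → k ≤ n → f k ≤ g k) → shift 0 t f n ≤ shift 0 t g n
  shift-mono zero    n       f≤g = f≤g n ≤-refl
  shift-mono (suc t) zero    f≤g = z≤n
  shift-mono (suc t) (suc n) f≤g = shift-mono t n (λ k k≤n → f≤g k (m≤n⇒m≤1+n k≤n))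

  sum<-mono : ∀ n {f g : ℕ → ℕ} → (∀ k → f k ≤ g k) → sum< n f ≤ sum< n g
  sum<-mono zero    f≤g = z≤n
  sum<-mono (suc n) f≤g = +-mono-≤ (sum<-mono n f≤g) (f≤g n)

  sum<-≤-+ : ∀ d n f → sum< n f ≤ sum< (d + n) f
  sum<-≤-+ zero    n f = ≤-refl
  sum<-≤-+ (suc d) n f = ≤-trans (sum<-≤-+ d n f) (m≤m+n _ _)

  tri-mono : ∀ {m n} → m ≤ n → tri m ≤ tri n
  tri-mono z≤n       = z≤n
  tri-mono (s≤s m≤n) = +-mono-≤ (s≤s m≤n) (tri-mono m≤n)

  2tri : ∀ n → 2 * tri n ≡ n * suc n
  2tri zero    = refl
  2tri (suc n) = begin
    2 * (suc n + tri n)      ≡⟨ *-distribˡ-+ 2 (suc n) (tri n) ⟩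
    2 * suc n + 2 * tri n    ≡⟨ cong (2 * suc n +_) (2tri n) ⟩
    2 * suc n + n * suc n    ≡⟨ *-distribʳ-+ (suc n) 2 n ⟨
    suc (suc n) * suc n      ≡⟨ *-comm (suc (suc n)) (suc n) ⟩
    suc n * suc (suc n)      ∎
    where open ≡-Reasoning

  sum<-2tri : ∀ n → 3 * sum< (suc n) (λ a → 2 * tri a) ≡ n * suc n * suc (suc n)
  sum<-2tri zero    = refl
  sum<-2tri (suc n) = begin
    3 * (s + 2 * tri (suc n))                          ≡⟨ *-distribˡ-+ 3 s _ ⟩
    3 * s + 3 * (2 * tri (suc n))                      ≡⟨ cong₂ (λ a b → a + 3 * b) (sum<-2tri n) (2tri (suc n)) ⟩
    n * suc n * suc (suc n) + 3 * (suc n * suc (suc n)) ≡⟨ solve 1 (λ n → let n₁ = con 1 :+ n; n₂ = con 2 :+ n in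
                                                             n :* n₁ :* n₂ :+ con 3 :* (n₁ :* n₂) := n₁ :* n₂ :* (con 3 :+ n)) refl n ⟩
    suc n * suc (suc n) * suc (suc (suc n))            ∎
    where
    open ≡-Reasoning
    open ℕ-Solver
    s = sum< (suc n) (λ a → 2 * tri a)

  triangular-rows : ∀ L m (f : ℕ → ℕ) N → N < tri m →
    sum< L (λ a → shift 0 (tri a) f N) ≤ sum< m (λ a → shift 0 (tri a) f N)
  -- Extending the range to L + m avoids comparing L with m; the terms from m on are zero and drop
  -- out.
  triangular-rows L m f N N<tm = ≤-trans (sum<-≤-+ m L _)
    (≤-trans (≤-reflexive (cong (λ k → sum< k (λ a → shift 0 (tri a) f N)) (+-comm m L))) (drop L))
    where
    drop : ∀ d → sum< (d + m) (λ a → shift 0 (tri a) f N) ≤ sum< m (λ a → shift 0 (tri a) f N)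
    drop zero    = ≤-refl
    drop (suc d) = ≤-trans (≤-reflexive (trans
      (cong (sum< (d + m) (λ a → shift 0 (tri a) f N) +_)
        (shift-< (tri (d + m)) f N (<-≤-trans N<tm (tri-mono (m≤n+m m d))))) (+-identityʳ _))) (drop d)

  even≤1 : ∀ n → even n ≤ 1
  even≤1 0             = ≤-refl
  even≤1 1             = z≤n
  even≤1 (suc (suc n)) = even≤1 n

  even-+-suc : ∀ n → even n + even (suc n) ≡ 1
  even-+-suc 0             = refl
  even-+-suc 1             = refl
  even-+-suc (suc (suc n)) = even-+-suc n

  even-+-2* : ∀ k n → even (2 * k + n) ≡ even n
  even-+-2* zero    n = refl
  even-+-2* (suc k) n = trans (cong (λ j → even (j + n)) (*-suc 2 k)) (even-+-2* k n)

  -- n - t and t + n have the same parity, and dropping the cutoff t ≤ n can only increase the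
  -- value.
  shift-even : ∀ t n → shift 0 t even n ≤ even (t + n)
  shift-even zero    n       = ≤-refl
  shift-even (suc t) zero    = z≤n
  shift-even (suc t) (suc n) = ≤-trans (shift-even t n) (≤-reflexive (cong (λ j → even (suc j)) (sym (+-suc t n))))

  module _ (M : ℕ) where
    private
      e : ℕ → ℕ
      e b = even (tri b + M)

    -- T_(b+2) - T_b = 2b + 3 is odd.
    e-pair : ∀ b → e b + e (2 + b) ≡ 1
    e-pair b = trans (cong (e b +_) (trans (cong even index) (even-+-2* (suc b) _))) (even-+-suc (tri b + M))
      where
      open ℕ-Solver
      index : tri (2 + b) + M ≡ 2 * suc b + suc (tri b + M)
      index = solve 3 (λ b t M → con 2 :+ b :+ (con 1 :+ b :+ t) :+ M := con 2 :* (con 1 :+ b) :+ (con 1 :+ (t :+ M))) refl b (tri b) M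

    -- Among any four consecutive triangular numbers exactly two have a given parity.
    parity-count : ∀ K → 2 * sum< K e ≤ suc K
    parity-count 0 = z≤n
    parity-count 1 = *-monoʳ-≤ 2 (even≤1 M)
    parity-count 2 = ≤-trans (*-monoʳ-≤ 2 (≤-reflexive (even-+-suc M))) (n≤1+n 2)
    parity-count 3 = begin
      2 * (e 0 + e 1 + e 2)   ≡⟨ solve 3 (λ a b c → con 2 :* (a :+ b :+ c) := con 2 :* ((a :+ c) :+ b)) refl (e 0) (e 1) (e 2) ⟩
      2 * ((e 0 + e 2) + e 1) ≤⟨ *-monoʳ-≤ 2 (+-mono-≤ (≤-reflexive (e-pair 0)) (even≤1 (tri 1 + M))) ⟩
      4                       ∎
      where
      open ≤-Reasoning
      open ℕ-Solver
    parity-count (suc (suc (suc (suc K)))) = begin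
      2 * (s + e K + e (1 + K) + e (2 + K) + e (3 + K))
        ≡⟨ solve 5 (λ s a b c d → con 2 :* (s :+ a :+ b :+ c :+ d) := con 2 :* ((a :+ c) :+ (b :+ d)) :+ con 2 :* s) refl s _ _ _ _ ⟩
      2 * ((e K + e (2 + K)) + (e (1 + K) + e (3 + K))) + 2 * s
        ≡⟨ cong₂ (λ a b → 2 * (a + b) + 2 * s) (e-pair K) (e-pair (1 + K)) ⟩
      4 + 2 * s
        ≤⟨ +-monoʳ-≤ 4 (parity-count K) ⟩
      5 + K ∎
      where
      open ≤-Reasoning
      open ℕ-Solver
      s = sum< K e

    row-parity : ∀ L → 2 * row L M ≤ suc L
    row-parity L = ≤-trans (*-monoʳ-≤ 2 (sum<-mono L (λ b → shift-even (tri b) M))) (parity-count L)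

    -- With B the largest index below L such that T_B ≤ M, only the first B + 1 terms can be
    -- nonzero, and `row-parity` for that many terms gives B + 2. For L = 0 the row is empty and B =
    -- 0 serves.
    row-bound : ∀ L → ∃ λ B → tri B ≤ M × 2 * row L M ≤ 2 + B
    row-bound zero    = 0 , z≤n , z≤n
    row-bound (suc L) with tri L ≤? M | row-bound L
    ... | yes tL≤M | _               = L , tL≤M , row-parity (suc L)
    ... | no  tL≰M | B , tB≤M , 2row≤ = B , tB≤M ,
      ≤-trans (≤-reflexive (cong (2 *_) (trans (cong (row L M +_) (shift-< (tri L) even M (≰⇒> tL≰M))) (+-identityʳ _)))) 2row≤

  2mn≤m²+n² : ∀ m n → 2 * (m * n) ≤ m * m + n * n
  2mn≤m²+n² m n with ≤-total m n
  ... | inj₁ m≤n with d , refl ← m≤n⇒∃[o]m+o≡n m≤n = begin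
    2 * (m * (m + d))                ≤⟨ m≤m+n _ (d * d) ⟩
    2 * (m * (m + d)) + d * d        ≡⟨ solve 2 (λ m d → con 2 :* (m :* (m :+ d)) :+ d :* d := m :* m :+ (m :+ d) :* (m :+ d)) refl m d ⟩
    m * m + (m + d) * (m + d)        ∎
    where
    open ≤-Reasoning
    open ℕ-Solver
  ... | inj₂ n≤m with d , refl ← m≤n⇒∃[o]m+o≡n n≤m = begin
    2 * ((n + d) * n)                ≤⟨ m≤m+n _ (d * d) ⟩
    2 * ((n + d) * n) + d * d        ≡⟨ solve 2 (λ n d → con 2 :* ((n :+ d) :* n) :+ d :* d := (n :+ d) :* (n :+ d) :+ n :* n) refl n d ⟩
    (n + d) * (n + d) + n * n        ∎
    where
    open ≤-Reasoning
    open ℕ-Solver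

  -- The tangent of the concave map M ↦ B at B = c, where B is the largest index with tri B ≤ M.
  row-tangent : ∀ c L M → (2 * c + 1) * (2 * row L M) ≤ 2 * M + (c * c + 2 * (2 * c + 1))
  row-tangent c L M with B , tB≤M , 2row≤ ← row-bound M L = begin
    (2 * c + 1) * (2 * row L M)                  ≤⟨ *-monoʳ-≤ (2 * c + 1) 2row≤ ⟩
    (2 * c + 1) * (2 + B)                        ≡⟨ solve 2 (λ c B → (con 2 :* c :+ con 1) :* (con 2 :+ B)
                                                     := con 2 :* (B :* c) :+ (B :+ con 2 :* (con 2 :* c :+ con 1))) refl c B ⟩
    2 * (B * c) + (B + 2 * (2 * c + 1))          ≤⟨ +-monoˡ-≤ _ (2mn≤m²+n² B c) ⟩
    B * B + c * c + (B + 2 * (2 * c + 1))        ≡⟨ solve 2 (λ c B → B :* B :+ c :* c :+ (B :+ con 2 :* (con 2 :* c :+ con 1))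
                                                     := B :* (con 1 :+ B) :+ (c :* c :+ con 2 :* (con 2 :* c :+ con 1))) refl c B ⟩
    B * suc B + (c * c + 2 * (2 * c + 1))        ≡⟨ cong (_+ (c * c + 2 * (2 * c + 1))) (2tri B) ⟨
    2 * tri B + (c * c + 2 * (2 * c + 1))        ≤⟨ +-monoˡ-≤ _ (*-monoʳ-≤ 2 tB≤M) ⟩
    2 * M + (c * c + 2 * (2 * c + 1))            ∎
    where
    open ≤-Reasoning
    open ℕ-Solver

  -- `row-tangent` with M = N - T_a, summed over a < m; the terms 2T_a stand on the left to keep
  -- clear of truncated subtraction.
  total-tangent : ∀ c L N m → (∀ a → a < m → tri a ≤ N) →
    (2 * c + 1) * (2 * total m L N) + sum< m (λ a → 2 * tri a) ≤ m * (2 * N + (c * c + 2 * (2 * c + 1)))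
  total-tangent c L N zero    _    = ≤-reflexive (trans (+-identityʳ _) (*-zeroʳ (2 * c + 1)))
  total-tangent c L N (suc m) tri≤ = begin
    k * (2 * (w + v)) + (s + 2 * tri m)
      ≡⟨ solve 5 (λ k w v s t → k :* (con 2 :* (w :+ v)) :+ (s :+ t) := (k :* (con 2 :* v) :+ t) :+ (k :* (con 2 :* w) :+ s))
           refl k w v s (2 * tri m) ⟩
    (k * (2 * v) + 2 * tri m) + (k * (2 * w) + s)
      ≤⟨ +-mono-≤ last (total-tangent c L N m (λ a a<m → tri≤ a (m<n⇒m<1+n a<m))) ⟩
    suc m * (2 * N + z) ∎
    where
    open ≤-Reasoning
    open ℕ-Solver
    k = 2 * c + 1
    z = c * c + 2 * (2 * c + 1)
    w = total m L N
    v = shift 0 (tri m) (row L) N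
    s = sum< m (λ a → 2 * tri a)
    last : k * (2 * v) + 2 * tri m ≤ 2 * N + z
    last = begin
      k * (2 * v) + 2 * tri m                      ≡⟨ cong (λ x → k * (2 * x) + 2 * tri m) (shift-≤ (tri m) (row L) N (tri≤ m ≤-refl)) ⟩
      k * (2 * row L (N ∸ tri m)) + 2 * tri m      ≤⟨ +-monoˡ-≤ _ (row-tangent c L (N ∸ tri m)) ⟩
      2 * (N ∸ tri m) + z + 2 * tri m              ≡⟨ solve 3 (λ a z t → con 2 :* a :+ z :+ con 2 :* t := con 2 :* (a :+ t) :+ z) refl (N ∸ tri m) z (tri m) ⟩
      2 * (N ∸ tri m + tri m) + z                  ≡⟨ cong (λ x → 2 * x + z) (m∸n+n≡m (tri≤ m ≤-refl)) ⟩
      2 * N + z                                    ∎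

  triangular-floor : ∀ N → ∃ λ A → tri A ≤ N × N < tri (suc A)
  triangular-floor zero = 0 , z≤n , s≤s z≤n
  triangular-floor (suc N) with A , tA≤N , N<t ← triangular-floor N with m≤n⇒m<n∨m≡n N<t
  ... | inj₁ 1+N<t = A , m≤n⇒m≤1+n tA≤N , 1+N<t
  ... | inj₂ 1+N≡t = suc A , ≤-reflexive (sym 1+N≡t) ,
    ≤-trans (s≤s (≤-reflexive 1+N≡t)) (s≤s (m≤n+m (tri (suc A)) (suc A)))

  -- By contradiction: a total of at least N + 2, put into `total-tangent` with c = A = 8 + t and A
  -- + 1 rows, yields an inequality that `lower` refutes.
  total-large : ∀ t L N → tri (8 + t) ≤ N → total (9 + t) L N ≤ suc N
  total-large t L N tA≤N with total (9 + t) L N ≤? suc N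
  ... | yes w≤ = w≤
  ... | no  w≰ with s , refl ← m≤n⇒∃[o]m+o≡n tA≤N = contradiction upper (<⇒≱ lower)
    where
    open ℕ-Solver
    A = 8 + t
    n₂ = A * suc A + 2 * s
    2N : 2 * (tri A + s) ≡ n₂
    2N = trans (*-distribˡ-+ 2 (tri A) s) (cong (_+ 2 * s) (2tri A))
    z = A * A + 2 * (2 * A + 1)
    -- The factor 3 clears the denominator of ∑ 2T_a = A(A + 1)(A + 2)/3; `n₂` is 2N, and `n₂ + 4`
    -- comes from the assumed N + 2.
    upper : 3 * ((2 * A + 1) * (n₂ + 4)) + A * suc A * suc (suc A) ≤ 3 * (suc A * (n₂ + z))
    upper = begin
      3 * ((2 * A + 1) * (n₂ + 4)) + A * suc A * suc (suc A)
        ≡⟨ cong₂ (λ x y → 3 * ((2 * A + 1) * x) + y)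
             (trans (cong (_+ 4) (sym 2N)) (sym (trans (cong (2 *_) (+-comm 2 N)) (*-distribˡ-+ 2 N 2)))) (sym (sum<-2tri A)) ⟩
      3 * ((2 * A + 1) * (2 * (2 + N))) + 3 * sum< (suc A) (λ a → 2 * tri a)
        ≡⟨ *-distribˡ-+ 3 ((2 * A + 1) * (2 * (2 + N))) _ ⟨
      3 * ((2 * A + 1) * (2 * (2 + N)) + sum< (suc A) (λ a → 2 * tri a))
        ≤⟨ *-monoʳ-≤ 3 (+-monoˡ-≤ _ (*-monoʳ-≤ (2 * A + 1) (*-monoʳ-≤ 2 (≰⇒> w≰)))) ⟩
      3 * ((2 * A + 1) * (2 * total (suc A) L N) + sum< (suc A) (λ a → 2 * tri a))
        ≤⟨ *-monoʳ-≤ 3 (total-tangent A L N (suc A) (λ { a (s≤s a≤A) → ≤-trans (tri-mono a≤A) tA≤N })) ⟩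
      3 * (suc A * (2 * N + z))
        ≡⟨ cong (λ x → 3 * (suc A * (x + z))) 2N ⟩
      3 * (suc A * (n₂ + z)) ∎
      where open ≤-Reasoning
    -- The difference of the two sides is 6sA + A(A-1)(A-8) + 6.
    lower : 3 * (suc A * (n₂ + z)) < 3 * ((2 * A + 1) * (n₂ + 4)) + A * suc A * suc (suc A)
    lower = ≤-trans (m≤m+n _ (6 * (s * A) + A * (7 + t) * t + 5)) (≤-reflexive
      (solve 2 (λ t s → let A = con 8 :+ t; n₂ = A :* (con 1 :+ A) :+ con 2 :* s in
        con 1 :+ con 3 :* ((con 1 :+ A) :* (n₂ :+ (A :* A :+ con 2 :* (con 2 :* A :+ con 1))))
          :+ (con 6 :* (s :* A) :+ A :* (con 7 :+ t) :* t :+ con 5)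
        := con 3 :* ((con 2 :* A :+ con 1) :* (n₂ :+ con 4)) :+ A :* (con 1 :+ A) :* (con 2 :+ A)) refl t s))

  -- 36 is T_8, so below it eight indices per sum suffice; the 36 cases are decided by evaluation.
  total-small : ∀ {N} → N < 36 → total 8 8 N ≤ suc N
  total-small = from-yes (allUpTo? (λ N → total 8 8 N ≤? suc N) 36)

  total-bound : ∀ L N → total L L N ≤ suc N
  total-bound L N with N <? 36
  ... | yes N<36 = begin
    total L L N ≤⟨ triangular-rows L 8 (row L) N N<36 ⟩
    total 8 L N ≤⟨ sum<-mono 8 (λ a → shift-mono (tri a) N (λ k k≤N → triangular-rows L 8 even k (≤-<-trans k≤N N<36))) ⟩
    total 8 8 N ≤⟨ total-small N<36 ⟩
    suc N       ∎
    where open ≤-Reasoning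
  ... | no N≮36 with A , tA≤N , N<t ← triangular-floor N with 8 ≤? A
  -- A < 8 would force N < T_8 = 36.
  ...   | no 8≰A = contradiction (<-≤-trans N<t (tri-mono (≰⇒> 8≰A))) N≮36
  ...   | yes 8≤A with t , refl ← m≤n⇒∃[o]m+o≡n 8≤A =
    ≤-trans (triangular-rows L (9 + t) (row L) N N<t) (total-large t L N tA≤N)

-- Arithmetic of formal power series.

open import Data.Integer using (+_; 0ℤ; 1ℤ; _≤_; +≤+)
open import Relation.Binary.PropositionalEquality
open TriangularCount using (shift; shift-<; sum<; even; row; total; total-bound)

sumTo-cong : ∀ n {f g : ℕ → ℤ} → (∀ k → k ℕ.≤ n → f k ≡ g k) → sumTo n f ≡ sumTo n g
sumTo-cong zero    f≡g = f≡g 0 z≤n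
sumTo-cong (suc n) f≡g =
  cong₂ ℤ._+_ (sumTo-cong n (λ k k≤n → f≡g k (ℕ.m≤n⇒m≤1+n k≤n))) (f≡g (suc n) ℕ.≤-refl)

sumTo-front : ∀ n (f : ℕ → ℤ) → sumTo (suc n) f ≡ f 0 ℤ.+ sumTo n (f ∘ suc)
sumTo-front zero    f = refl
sumTo-front (suc n) f = trans (cong (ℤ._+ f (suc (suc n))) (sumTo-front n f)) (ℤ.+-assoc (f 0) _ _)

sumTo-0 : ∀ n {f : ℕ → ℤ} → (∀ k → f k ≡ 0ℤ) → sumTo n f ≡ 0ℤ
sumTo-0 zero    f≡0 = f≡0 0
sumTo-0 (suc n) f≡0 = cong₂ ℤ._+_ (sumTo-0 n f≡0) (f≡0 (suc n))

sumTo-+ : ∀ n (f g : ℕ → ℤ) → sumTo n (λ k → f k ℤ.+ g k) ≡ sumTo n f ℤ.+ sumTo n g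
sumTo-+ zero    f g = refl
sumTo-+ (suc n) f g = trans (cong (ℤ._+ (f (suc n) ℤ.+ g (suc n))) (sumTo-+ n f g))
  (solve 4 (λ a b c d → (a :+ b) :+ (c :+ d) := (a :+ c) :+ (b :+ d)) refl (sumTo n f) (sumTo n g) (f (suc n)) (g (suc n)))
  where open ℤ-Solver

sumTo-* : ∀ n c (f : ℕ → ℤ) → sumTo n (λ k → c ℤ.* f k) ≡ c ℤ.* sumTo n f
sumTo-* zero    c f = refl
sumTo-* (suc n) c f = trans (cong (ℤ._+ c ℤ.* f (suc n)) (sumTo-* n c f)) (sym (ℤ.*-distribˡ-+ c _ _))

infixl 6 _⊕_
_⊕_ : FPS → FPS → FPS
(f ⊕ g) n = f n ℤ.+ g n

⊛-front : ∀ f g n → (f ⊛ g) (suc n) ≡ f 0 ℤ.* g (suc n) ℤ.+ ((f ∘ suc) ⊛ g) n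
⊛-front f g n = sumTo-front n (λ k → f k ℤ.* g (suc n ∸ k))

⊛-back : ∀ f g n → (f ⊛ g) (suc n) ≡ (f ⊛ (g ∘ suc)) n ℤ.+ f (suc n) ℤ.* g 0
⊛-back f g n = cong₂ ℤ._+_
  (sumTo-cong n (λ k k≤n → cong (λ i → f k ℤ.* g i) (ℕ.+-∸-assoc 1 k≤n)))
  (cong (λ i → f (suc n) ℤ.* g i) (ℕ.n∸n≡0 n))

-- Peeling the first term of one product and the last term of the other leaves the same claim one
-- degree lower.
⊛-comm : ∀ f g n → (f ⊛ g) n ≡ (g ⊛ f) n
⊛-comm f g zero    = ℤ.*-comm (f 0) (g 0)
⊛-comm f g (suc n) = begin
  (f ⊛ g) (suc n)                                   ≡⟨ ⊛-front f g n ⟩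
  f 0 ℤ.* g (suc n) ℤ.+ ((f ∘ suc) ⊛ g) n           ≡⟨ cong₂ ℤ._+_ (ℤ.*-comm (f 0) _) (⊛-comm (f ∘ suc) g n) ⟩
  g (suc n) ℤ.* f 0 ℤ.+ (g ⊛ (f ∘ suc)) n           ≡⟨ ℤ.+-comm (g (suc n) ℤ.* f 0) _ ⟩
  (g ⊛ (f ∘ suc)) n ℤ.+ g (suc n) ℤ.* f 0           ≡⟨ ⊛-back g f n ⟨
  (g ⊛ f) (suc n)                                   ∎
  where open ≡-Reasoning

⊛-distribʳ : ∀ f g h n → ((g ⊕ h) ⊛ f) n ≡ (g ⊛ f) n ℤ.+ (h ⊛ f) n
⊛-distribʳ f g h n = trans (sumTo-cong n (λ k _ → ℤ.*-distribʳ-+ (f (n ∸ k)) (g k) (h k))) (sumTo-+ n _ _)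

⊛-scaleˡ : ∀ c f g n → ((λ k → c ℤ.* f k) ⊛ g) n ≡ c ℤ.* (f ⊛ g) n
⊛-scaleˡ c f g n = trans (sumTo-cong n (λ k _ → ℤ.*-assoc c (f k) (g (n ∸ k)))) (sumTo-* n c _)

-- Coefficient n of a product sees only coefficients up to n of the factors, which makes truncation
-- compatible with multiplication.
⊛-congˡ : ∀ {f f′} g n → (∀ k → k ℕ.≤ n → f k ≡ f′ k) → (f ⊛ g) n ≡ (f′ ⊛ g) n
⊛-congˡ g n f≡ = sumTo-cong n (λ k k≤n → cong (ℤ._* g (n ∸ k)) (f≡ k k≤n))

⊛-congʳ : ∀ f {g g′} n → (∀ k → k ℕ.≤ n → g k ≡ g′ k) → (f ⊛ g) n ≡ (f ⊛ g′) n
⊛-congʳ f n g≡ = sumTo-cong n (λ k _ → cong (f k ℤ.*_) (g≡ (n ∸ k) (ℕ.m∸n≤m n k)))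

⊛-assoc : ∀ f g h n → ((f ⊛ g) ⊛ h) n ≡ (f ⊛ (g ⊛ h)) n
⊛-assoc f g h zero    = ℤ.*-assoc (f 0) (g 0) (h 0)
⊛-assoc f g h (suc n) = begin
  ((f ⊛ g) ⊛ h) (suc n)
    ≡⟨ ⊛-front (f ⊛ g) h n ⟩
  f 0 ℤ.* g 0 ℤ.* h (suc n) ℤ.+ (((f ⊛ g) ∘ suc) ⊛ h) n
    ≡⟨ cong (λ x → f 0 ℤ.* g 0 ℤ.* h (suc n) ℤ.+ x) (⊛-congˡ h n (λ k _ → ⊛-front f g k)) ⟩
  f 0 ℤ.* g 0 ℤ.* h (suc n) ℤ.+ (((λ k → f 0 ℤ.* g (suc k)) ⊕ ((f ∘ suc) ⊛ g)) ⊛ h) n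
    ≡⟨ cong (λ x → f 0 ℤ.* g 0 ℤ.* h (suc n) ℤ.+ x) (trans (⊛-distribʳ h (λ k → f 0 ℤ.* g (suc k)) ((f ∘ suc) ⊛ g) n)
         (cong₂ ℤ._+_ (⊛-scaleˡ (f 0) (g ∘ suc) h n) (⊛-assoc (f ∘ suc) g h n))) ⟩
  f 0 ℤ.* g 0 ℤ.* h (suc n) ℤ.+ (f 0 ℤ.* ((g ∘ suc) ⊛ h) n ℤ.+ ((f ∘ suc) ⊛ (g ⊛ h)) n)
    ≡⟨ solve 5 (λ a b c d e → a :* b :* c :+ (a :* d :+ e) := a :* (b :* c :+ d) :+ e) refl
         (f 0) (g 0) (h (suc n)) (((g ∘ suc) ⊛ h) n) (((f ∘ suc) ⊛ (g ⊛ h)) n) ⟩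
  f 0 ℤ.* (g 0 ℤ.* h (suc n) ℤ.+ ((g ∘ suc) ⊛ h) n) ℤ.+ ((f ∘ suc) ⊛ (g ⊛ h)) n
    ≡⟨ cong (λ x → f 0 ℤ.* x ℤ.+ ((f ∘ suc) ⊛ (g ⊛ h)) n) (⊛-front g h n) ⟨
  f 0 ℤ.* (g ⊛ h) (suc n) ℤ.+ ((f ∘ suc) ⊛ (g ⊛ h)) n
    ≡⟨ ⊛-front f (g ⊛ h) n ⟨
  (f ⊛ (g ⊛ h)) (suc n) ∎
  where
  open ≡-Reasoning
  open ℤ-Solver

⊛-zeroˡ : ∀ f n → ((λ _ → 0ℤ) ⊛ f) n ≡ 0ℤ
⊛-zeroˡ f n = sumTo-0 n (λ k → ℤ.*-zeroˡ (f (n ∸ k)))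

⊛-identityˡ : ∀ f n → (one ⊛ f) n ≡ f n
⊛-identityˡ f zero    = ℤ.*-identityˡ (f 0)
⊛-identityˡ f (suc n) = trans (⊛-front one f n)
  (trans (cong₂ ℤ._+_ (ℤ.*-identityˡ (f (suc n))) (⊛-zeroˡ f n)) (ℤ.+-identityʳ (f (suc n))))

qPow-⊛ : ∀ t f n → (qPow t ⊛ f) n ≡ shift 0ℤ t f n
qPow-⊛ zero    f n       = trans (⊛-congˡ {qPow 0} {one} f n (λ { zero _ → refl ; (suc _) _ → refl })) (⊛-identityˡ f n)
qPow-⊛ (suc t) f zero    = ℤ.*-zeroˡ (f 0)
qPow-⊛ (suc t) f (suc n) = trans (⊛-front (qPow (suc t)) f n)
  (trans (cong₂ ℤ._+_ (ℤ.*-zeroˡ (f (suc n))) (qPow-⊛ t f n)) (ℤ.+-identityˡ _))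

qPow-< : ∀ {t n} → n ℕ.< t → qPow t n ≡ 0ℤ
qPow-< {t} {n} n<t = cong (if_then 1ℤ else 0ℤ) (dec-false (t ℕ.≟ n) (ℕ.<⇒≢ n<t ∘ sym))

qPow-+ : ∀ m n k → qPow (m ℕ.+ n) k ≡ shift 0ℤ m (qPow n) k
qPow-+ zero    n k       = refl
qPow-+ (suc m) n zero    = refl
qPow-+ (suc m) n (suc k) = qPow-+ m n k

geomSuc-< : ∀ k n → n ℕ.< suc k → geomSuc k n ≡ one n
geomSuc-< k zero    _   = cong (if_then 1ℤ else 0ℤ) (dec-true (suc k ∣? 0) (suc k ∣0))
geomSuc-< k (suc n) n<k = cong (if_then 1ℤ else 0ℤ) (dec-false (suc k ∣? suc n) (λ k∣n → ℕ.<⇒≱ n<k (∣⇒≤ k∣n)))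

geomSuc-periodic : ∀ k n → geomSuc k (suc k ℕ.+ n) ≡ geomSuc k n
geomSuc-periodic k n = cong (if_then 1ℤ else 0ℤ)
  (does-⇔ (mk⇔ (λ d → ∣m+n∣m⇒∣n d ∣-refl) (∣m∣n⇒∣m+n ∣-refl)) (suc k ∣? (suc k ℕ.+ n)) (suc k ∣? n))

shift-+ : ∀ {A : Set} {z : A} t f n → shift z t f (t ℕ.+ n) ≡ f n
shift-+ zero    f n = refl
shift-+ (suc t) f n = shift-+ t f n

-- Coefficientwise form of G = 1 + q^(k+1) G, the identity behind (1 - q^(k+1)) G = 1.
geomSuc-unfold : ∀ k n → geomSuc k n ≡ one n ℤ.+ shift 0ℤ (suc k) (geomSuc k) n
geomSuc-unfold k n with n ℕ.<? suc k
... | yes n<k = trans (geomSuc-< k n n<k)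
  (sym (trans (cong (λ x → one n ℤ.+ x) (shift-< (suc k) (geomSuc k) n n<k)) (ℤ.+-identityʳ (one n))))
... | no n≮k with m , refl ← ℕ.m≤n⇒∃[o]m+o≡n (ℕ.≮⇒≥ n≮k) = trans (geomSuc-periodic k m)
  (sym (trans (cong (λ x → 0ℤ ℤ.+ x) (shift-+ (suc k) (geomSuc k) m)) (ℤ.+-identityˡ (geomSuc k m))))

-- Factor j agrees with 1 through degree j, so the factors after the k-th leave coefficient k
-- unchanged.
finProd-stable : ∀ {F : ℕ → FPS} → (∀ j i → i ℕ.≤ j → F j i ≡ one i) →
  ∀ {k n} → k ℕ.≤ n → finProd (suc n) F k ≡ finProd (suc k) F k
finProd-stable {F} F≡one {k} k≤n with d , refl ← ℕ.m≤n⇒∃[o]m+o≡n k≤n =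
  subst (λ j → finProd (suc j) F k ≡ finProd (suc k) F k) (ℕ.+-comm d k) (go d)
  where
  go : ∀ d → finProd (suc (d ℕ.+ k)) F k ≡ finProd (suc k) F k
  go zero    = refl
  go (suc d) = begin
    (G ⊛ F (suc (d ℕ.+ k))) k   ≡⟨ ⊛-congʳ G k (λ i i≤k → F≡one _ i (ℕ.≤-trans i≤k (ℕ.m≤n+m k (suc d)))) ⟩
    (G ⊛ one) k                 ≡⟨ ⊛-comm G one k ⟩
    (one ⊛ G) k                 ≡⟨ ⊛-identityˡ G k ⟩
    G k                         ≡⟨ go d ⟩
    finProd (suc k) F k         ∎
    where
    open ≡-Reasoning
    G = finProd (suc (d ℕ.+ k)) F

-- The truncated power series ring.

-- The ring ℤ[[q]]/(q^(N+1)).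
module Truncated (N : ℕ) where

  infix 4 _≈_
  record _≈_ (f g : FPS) : Set where
    constructor pointwise
    field at : ∀ k → k ℕ.≤ N → f k ≡ g k
  open _≈_ public

  ≡⇒≈ : ∀ {f g} → (∀ k → f k ≡ g k) → f ≈ g
  ≡⇒≈ f≡g = pointwise (λ k _ → f≡g k)

  ⊛-cong : ∀ {f f′ g g′} → f ≈ f′ → g ≈ g′ → f ⊛ g ≈ f′ ⊛ g′
  ⊛-cong {f} {f′} {g} f≈ g≈ = pointwise (λ n n≤N → trans
    (⊛-congˡ g n (λ k k≤n → at f≈ k (ℕ.≤-trans k≤n n≤N)))
    (⊛-congʳ f′ n (λ k k≤n → at g≈ k (ℕ.≤-trans k≤n n≤N))))

  FPS-ring : CommutativeRing 0ℓ 0ℓ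
  FPS-ring = record
    { Carrier = FPS
    ; _≈_     = _≈_
    ; _+_     = _⊕_
    ; _*_     = _⊛_
    ; -_      = λ f n → ℤ.- f n
    ; 0#      = λ _ → 0ℤ
    ; 1#      = one
    ; isCommutativeRing = record
      { isRing = record
        { +-isAbelianGroup = record
          { isGroup = record
            { isMonoid = record
              { isSemigroup = record
                { isMagma = record
                  { isEquivalence = record
                    { refl  = ≡⇒≈ (λ _ → refl)
                    ; sym   = λ f≈g → pointwise (λ k k≤N → sym (at f≈g k k≤N))
                    ; trans = λ f≈g g≈h → pointwise (λ k k≤N → trans (at f≈g k k≤N) (at g≈h k k≤N))
                    }
                  ; ∙-cong = λ f≈ g≈ → pointwise (λ k k≤N → cong₂ ℤ._+_ (at f≈ k k≤N) (at g≈ k k≤N))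
                  }
                ; assoc = λ f g h → ≡⇒≈ (λ k → ℤ.+-assoc (f k) (g k) (h k))
                }
              ; identity = (λ f → ≡⇒≈ (λ k → ℤ.+-identityˡ (f k))) , (λ f → ≡⇒≈ (λ k → ℤ.+-identityʳ (f k)))
              }
            ; inverse = (λ f → ≡⇒≈ (λ k → ℤ.+-inverseˡ (f k))) , (λ f → ≡⇒≈ (λ k → ℤ.+-inverseʳ (f k)))
            ; ⁻¹-cong = λ f≈ → pointwise (λ k k≤N → cong ℤ.-_ (at f≈ k k≤N))
            }
          ; comm = λ f g → ≡⇒≈ (λ k → ℤ.+-comm (f k) (g k))
          }
        ; *-cong     = ⊛-cong
        ; *-assoc    = λ f g h → ≡⇒≈ (⊛-assoc f g h)
        ; *-identity = (λ f → ≡⇒≈ (⊛-identityˡ f))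
                     , (λ f → ≡⇒≈ (λ k → trans (⊛-comm f one k) (⊛-identityˡ f k)))
        ; distrib    = (λ f g h → ≡⇒≈ (λ k → trans (⊛-comm f (g ⊕ h) k)
                         (trans (⊛-distribʳ f g h k) (cong₂ ℤ._+_ (⊛-comm g f k) (⊛-comm h f k)))))
                     , (λ f g h → ≡⇒≈ (⊛-distribʳ f g h))
        }
      ; *-comm = λ f g → ≡⇒≈ (⊛-comm f g)
      }
    }

  constant : ℤ → FPS
  constant c zero    = c
  constant c (suc _) = 0ℤ

  constant-homomorphism : ℤ.+-*-rawRing -Raw-AlmostCommutative⟶ fromCommutativeRing FPS-ring
  constant-homomorphism = record
    { ⟦_⟧    = constant
    ; +-homo = λ a b → ≡⇒≈ (λ { zero → refl ; (suc _) → refl })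
    ; *-homo = λ a b → ≡⇒≈ (λ { zero → refl ; (suc n) → sym (trans (⊛-front (constant a) (constant b) n)
                 (cong₂ ℤ._+_ (ℤ.*-zeroʳ a) (⊛-zeroˡ (constant b) n))) })
    ; -‿homo = λ a → ≡⇒≈ (λ { zero → refl ; (suc _) → refl })
    ; 0-homo = ≡⇒≈ (λ { zero → refl ; (suc _) → refl })
    ; 1-homo = ≡⇒≈ (λ { zero → refl ; (suc _) → refl })
    }

  module R = CommutativeRing FPS-ring

  O*geomSuc : ∀ k → (one R.- qPow (suc k)) ⊛ geomSuc k ≈ one
  O*geomSuc k = begin
    (one R.- qPow (suc k)) ⊛ G               ≈⟨ R.distribʳ G one _ ⟩
    (one ⊛ G) ⊕ ((R.- qPow (suc k)) ⊛ G)     ≈⟨ R.+-cong (R.*-identityˡ G) (R.sym (-‿distribˡ-* (qPow (suc k)) G)) ⟩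
    G R.- (qPow (suc k) ⊛ G)                 ≈⟨ ≡⇒≈ (λ n → trans
                                                  (cong₂ ℤ._-_ (geomSuc-unfold k n) (qPow-⊛ (suc k) G n))
                                                  (solve 2 (λ a b → a :+ b :- b := a) refl (one n) (shift 0ℤ (suc k) G n))) ⟩
    one                                      ∎
    where
    open SetoidReasoning R.setoid
    open RingProperties R.ring using (-‿distribˡ-*)
    open ℤ-Solver
    G = geomSuc k

  FPS-qRing : TruncatedQRing 0ℓ 0ℓ
  FPS-qRing = record
    { commutativeRing = FPS-ring
    ; fromℤ           = constant-homomorphism
    ; q               = qPow
    ; q-0             = ≡⇒≈ (λ { zero → refl ; (suc _) → refl })
    ; q-+             = λ m n → ≡⇒≈ (λ k → trans (qPow-+ m n k) (sym (qPow-⊛ m (qPow n) k)))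
    ; g               = geomSuc
    ; O*g             = O*geomSuc
    ; N               = N
    ; q-vanishes      = λ N<m → pointwise (λ k k≤N → qPow-< (ℕ.≤-<-trans k≤N N<m))
    }

  -- From the defining series to the count of pairs.

  ∑< ∏< : ℕ → (ℕ → FPS) → FPS
  ∑< = QProducts.∑< FPS-qRing
  ∏< = QProducts.∏< FPS-qRing

  E I V ψ : ℕ → FPS
  E = QProducts.E FPS-qRing
  I = QProducts.I FPS-qRing
  V = QProducts.V FPS-qRing
  ψ = QProducts.ψ FPS-qRing

  finProd≡∏< : ∀ n F → finProd n F ≡ ∏< n F
  finProd≡∏< zero    F = refl
  finProd≡∏< (suc n) F = cong (_⊛ F n) (finProd≡∏< n F)

  index-≤ : ∀ a j → j ℕ.≤ a ℕ.+ 2 ℕ.* j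
  index-≤ a j = ℕ.≤-trans (ℕ.m≤m+n j _) (ℕ.m≤n+m _ a)

  -- Coefficient k of `pochSucQ2` uses k + 1 factors, while `E` always has N + 1; `finProd-stable`
  -- reconciles the two.
  pochSucQ2≈E : ∀ a → pochSucQ2 a ≈ E a
  pochSucQ2≈E a = pointwise (λ k k≤N → trans
    (sym (finProd-stable
      (λ j i i≤j → trans (cong (λ x → one i ℤ.- x) (qPow-< (s≤s (ℕ.≤-trans i≤j (index-≤ a j))))) (ℤ.+-identityʳ (one i))) k≤N))
    (cong (λ f → f k) (finProd≡∏< (suc N) _)))

  invPochSucQ2≈I : ∀ a → invPochSucQ2 a ≈ I a
  invPochSucQ2≈I a = pointwise (λ k k≤N → trans
    (sym (finProd-stable
      (λ j i i≤j → geomSuc-< (a ℕ.+ 2 ℕ.* j) i (s≤s (ℕ.≤-trans i≤j (index-≤ a j)))) k≤N))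
    (cong (λ f → f k) (finProd≡∏< (suc N) _)))

  summand≈V : ∀ m → summand m ≈ V (2 ℕ.* m)
  summand≈V m
    -- `summand` has 2m + c where `V (2 * m)` has c + 2m.
    rewrite ℕ.+-comm (2 ℕ.* m) 2 | ℕ.+-comm (2 ℕ.* m) 3 | ℕ.+-comm (2 ℕ.* m) 5
    = ⊛-cong {x ⊛ A ⊛ B ⊛ C} {x ⊛ A′ ⊛ B′ ⊛ C′} {C} {C′}
        (⊛-cong {x ⊛ A ⊛ B} {x ⊛ A′ ⊛ B′} {C} {C′}
          (⊛-cong {x ⊛ A} {x ⊛ A′} {B} {B′}
            (⊛-cong {x} {x} {A} {A′} (≡⇒≈ (λ _ → refl)) (pochSucQ2≈E a))
            (pochSucQ2≈E b))
          (invPochSucQ2≈I c))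
        (invPochSucQ2≈I c)
    where
    a = 3 ℕ.+ 2 ℕ.* m
    b = 5 ℕ.+ 2 ℕ.* m
    c = 2 ℕ.+ 2 ℕ.* m
    x = qPow c
    A = pochSucQ2 a
    A′ = E a
    B = pochSucQ2 b
    B′ = E b
    C = invPochSucQ2 c
    C′ = I c

  sumTo≡∑< : ∀ n F k → sumTo n (λ m → F m k) ≡ ∑< (suc n) F k
  sumTo≡∑< zero    F k = sym (ℤ.+-identityˡ (F 0 k))
  sumTo≡∑< (suc n) F k = cong (ℤ._+ F (suc n) k) (sumTo≡∑< n F k)

  -- The truncation order is the index of the coefficient sought, so working modulo q^(N+1) loses
  -- nothing.
  D'₂₁≡ : D'₂₁ N ≡ (geomSuc 0 ⊛ geomSuc 0) N ℤ.- (ψ (2 ℕ.* suc N) ⊛ (ψ (2 ℕ.* suc N) ⊛ geomSuc 1)) N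
  D'₂₁≡ = begin
    sumTo N (λ m → summand m N)           ≡⟨ sumTo-cong N (λ m _ → at (summand≈V m) N ℕ.≤-refl) ⟩
    sumTo N (λ m → V (2 ℕ.* m) N)         ≡⟨ sumTo≡∑< N (λ m → V (2 ℕ.* m)) N ⟩
    ∑< (suc N) (λ m → V (2 ℕ.* m)) N      ≡⟨ at (QProducts.∑V-gauss FPS-qRing) N ℕ.≤-refl ⟩
    (geomSuc 0 ⊛ geomSuc 0) N ℤ.- (ψ (2 ℕ.* suc N) ⊛ (ψ (2 ℕ.* suc N) ⊛ geomSuc 1)) N ∎
    where open ≡-Reasoning

  shift-pos : ∀ t (h : ℕ → ℕ) n → shift 0ℤ t (λ k → + h k) n ≡ + shift 0 t h n
  shift-pos zero    h n       = refl
  shift-pos (suc t) h zero    = refl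
  shift-pos (suc t) h (suc n) = shift-pos t h n

  -- ψ is a sum of powers of q with triangular exponents, so multiplying by it adds shifted copies
  -- of `h` and keeps the coefficients natural numbers.
  ψ-⊛ : ∀ L (h : ℕ → ℕ) n → (ψ L ⊛ (λ k → + h k)) n ≡ + sum< L (λ a → shift 0 (tri a) h n)
  ψ-⊛ zero    h n = ⊛-zeroˡ (λ k → + h k) n
  ψ-⊛ (suc L) h n = trans (⊛-distribʳ (λ k → + h k) (ψ L) (qPow (tri L)) n)
    (cong₂ ℤ._+_ (ψ-⊛ L h n) (trans (qPow-⊛ (tri L) _ n) (shift-pos (tri L) h n)))

geomSuc-0 : ∀ n → geomSuc 0 n ≡ 1ℤ
geomSuc-0 n = cong (if_then 1ℤ else 0ℤ) (dec-true (1 ∣? n) (1∣ n))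

geomSuc-1 : ∀ n → geomSuc 1 n ≡ + even n
geomSuc-1 0             = refl
geomSuc-1 1             = refl
geomSuc-1 (suc (suc n)) = trans (geomSuc-periodic 1 n) (geomSuc-1 n)

geomSuc-0² : ∀ n → (geomSuc 0 ⊛ geomSuc 0) n ≡ + suc n
geomSuc-0² n = trans (sumTo-cong n (λ k _ → cong₂ ℤ._*_ (geomSuc-0 k) (geomSuc-0 (n ∸ k)))) (count n)
  where
  count : ∀ n → sumTo n (λ _ → 1ℤ) ≡ + suc n
  count zero    = refl
  count (suc n) = trans (cong (ℤ._+ 1ℤ) (count n)) (cong +_ (ℕ.+-comm (suc n) 1))

theorem3p3 : (n : ℕ) → 0ℤ ≤ D'₂₁ n
theorem3p3 n = subst (0ℤ ≤_) (sym value) (ℤ.i≤j⇒0≤j-i (+≤+ (total-bound L n)))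
  where
  open Truncated n
  L = 2 ℕ.* suc n
  value : D'₂₁ n ≡ + suc n ℤ.- + total L L n
  value = trans D'₂₁≡ (cong₂ ℤ._-_ (geomSuc-0² n) (begin
    -- 1/(1 - q²) turns into `row` after the first factor ψ and into `total` after the second.
    (ψ L ⊛ (ψ L ⊛ geomSuc 1)) n             ≡⟨ ⊛-congʳ (ψ L) n (λ k _ → trans (⊛-congʳ (ψ L) k (λ i _ → geomSuc-1 i)) (ψ-⊛ L even k)) ⟩
    (ψ L ⊛ (λ k → + row L k)) n             ≡⟨ ψ-⊛ L (row L) n ⟩
    + total L L n                           ∎))
    where open ≡-Reasoning
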